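{- Let $\mathbb B=(A,\prec_1,\prec_2)$ be a bi-subordination algebra, and for $i=1,2$ let $\Diamond_i a=\bigwedge\{b\in A\mid a\prec_i b\}$ and $\blacksquare_i a=\bigvee\{b\in A\mid b\prec_i a\}$ in $A^\delta$, extended to $A^\delta$ as $\Diamond_i^\sigma$, $\blacksquare_i^\pi$ (superscripts omitted). Inequalities are in $A^\delta$, with $a,b$ ranging over $A$. 1. $\prec_1\,\subseteq\,\prec_2$ iff $\Diamond_2a\le\Diamond_1a$ for all $a$. 2. $\prec_2\circ\prec_1\,\subseteq\,\le$ iff $\blacksquare_2a\le\Diamond_1a$ for all $a$. 3. If $A$ is a distributive lattice, then (i) (P1) holds iff $\blacksquare_1(a\vee b)\le\Diamond_2a\vee\blacksquare_1b$ for all $a,b$; (ii) (P2) holds iff $\blacksquare_1a\wedge\Diamond_2b\le\Diamond_2(a\wedge b)$ for all $a,b$. 4. $\prec_2\circ\prec_1\,\subseteq\,\prec_1\circ\prec_2$ iff $\Diamond_1\blacksquare_2a\le\blacksquare_2\Diamond_1a$ for all $a$. 5. $\prec_1\circ\prec_2\,\subseteq\,\prec_1$ iff $\Diamond_1a\le\Diamond_2\Diamond_1a$ for all $a$. 6. $\forall a\forall b\,(a\prec_1b\ \&\ a\prec_2b\Rightarrow b=\top)$ iff $\Diamond_1a\vee\Diamond_2a=\top$ for all $a$. 7. $\forall b\,(\forall a(a\prec_1b)\Rightarrow\forall a(a\prec_2b))$ iff $\Diamond_2\top\le\Diamond_1\top$. 8. $\forall a\,(\exists b(a\prec_1b\ \&\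 b\prec_2\bot)\Rightarrow a=\bot)$ iff $\blacksquare_1\blacksquare_2\bot=\bot$.
   Context: Canonical extension. For a poset $A$, $A^\delta$ is a complete lattice containing $A$ as a subposet. $k\in A^\delta$ is closed ($k\in K(A^\delta)$) if $k=\bigwedge F$ for some nonempty down-directed $F\subseteq A$; $o$ is open ($o\in O(A^\delta)$) if $o=\bigvee I$ for some nonempty up-directed $I\subseteq A$. Denseness: every element of $A^\delta$ is a join of closed elements and a meet of open elements. Compactness: if $F\subseteq A$ is nonempty down-directed, $I\subseteq A$ nonempty up-directed and $\bigwedge F\le\bigvee I$, then $a\le b$ for some $a\in F$, $b\in I$. $A^\delta$ exists and is unique up to isomorphism fixing $A$. A subordination algebra is a pair $(A,\prec)$ with $A$ a bounded lattice and $\prec\,\subseteq A\times A$ such that $\bot\prec\bot$; $\top\prec\top$; (SI) $a\le b\prec x\Rightarrow a\prec x$; (WO) $b\prec x\le y\Rightarrow b\prec y$; (AND) $a\prec x\ \&\ a\prec y\Rightarrow a\prec x\wedge y$; (OR) $a\prec x\ \&\ b\prec x\Rightarrow a\vee b\prec x$. A bi-subordination algebra is $(A,\prec_1,\prec_2)$ with both $(A,\prec_1)$ and $(A,\prec_2)$ subordination algebras. Extensions: $\Diamond^\sigma k=\bigwedge\{\Diamond a\mid a\in A,k\le a\}$ for $k$ closed, $\Diamond^\sigma u=\bigvee\{\Diamond^\sigma k\mid k\in K(A^\delta),k\le u\}$; $\blacksquare^\pi o=\bigvee\{\blacksquare a\mid a\in A,a\le o\}$ for $o$ open, $\blacksquare^\pi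 u=\bigwedge\{\blacksquare^\pi o\mid o\in O(A^\delta),u\le o\}$. Composition is read left to right: $x\,(R\circ S)\,y$ iff $x\,R\,z$ and $z\,S\,y$ for some $z\in A$. (P1) For all $a,b,c$: $c\prec_1a\vee b\Rightarrow\forall d[a\prec_2d\Rightarrow\exists e(e\prec_1b\ \&\ c\le e\vee d)]$. (P2) For all $a,b,c$: $a\wedge b\prec_2c\Rightarrow\forall d[d\prec_1a\Rightarrow\exists e(b\prec_2e\ \&\ d\wedge e\le c)]$. -}

module Defs where

open import Level using (Level; Lift; lower; suc; _⊔_)
open import Data.Product using (Σ; ∃; _×_; proj₁; proj₂)
open import Relation.Binary.Core using (Rel)
open import Relation.Binary.Bundles using (Poset)
open import Relation.Binary.Lattice.Bundles using (BoundedLattice)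
open import Relation.Binary.Morphism.Structures using (IsOrderMonomorphism)
open import Relation.Unary using (Pred)

-- Joins and meets are taken of families indexed by types in Set i, rather than
-- of predicates on the carrier.  Classically this is the same thing (a subset
-- is a family indexed by itself), but in a predicative theory a nontrivial
-- lattice need not have joins of families as large as its own carrier.
-- The binary operations and bounds are determined by the order.
record CompleteLattice (d e o i : Level) : Set (suc (d ⊔ e ⊔ o ⊔ i)) where
  field
    boundedLattice : BoundedLattice d e o

  open BoundedLattice boundedLattice public

  field
    ⋁          : {I : Set i} → (I → Carrier) → Carrier
    ⋀          : {I : Set i} → (I → Carrier) → Carrier
    ⋁-upper    : {I : Set i} (f : I → Carrier) → ∀ j → f j ≤ ⋁ f
    ⋁-least    : {I : Set i} (f : I → Carrier) → ∀ u → (∀ j → f j ≤ u) → ⋁ f ≤ u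
    ⋀-lower    : {I : Set i} (f : I → Carrier) → ∀ j → ⋀ f ≤ f j
    ⋀-greatest : {I : Set i} (f : I → Carrier) → ∀ u → (∀ j → u ≤ f j) → u ≤ ⋀ f

module _ {ℓ : Level} (P : Poset ℓ ℓ ℓ) where
  open Poset P

  DownDirected : Pred Carrier ℓ → Set ℓ
  DownDirected F = ∃ F × (∀ {x y} → F x → F y → ∃ λ z → F z × z ≤ x × z ≤ y)

  UpDirected : Pred Carrier ℓ → Set ℓ
  UpDirected I = ∃ I × (∀ {x y} → I x → I y → ∃ λ z → I z × x ≤ z × y ≤ z)

-- The index level of the complete lattice is at least suc ℓ ⊔ o, so that there
-- are joins and meets of families indexed by subsets F of the poset and by
-- proofs of ⋀ F ≤ u; the occurrences of Lift only adjust levels.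
record CanonicalExtension {ℓ : Level} (P : Poset ℓ ℓ ℓ) (d e o i : Level)
       : Set (suc (suc ℓ ⊔ d ⊔ e ⊔ o ⊔ i)) where
  private
    module P = Poset P
    κ : Level
    κ = suc ℓ ⊔ o ⊔ i

  field
    completeLattice : CompleteLattice d e o (suc ℓ ⊔ o ⊔ i)

  open CompleteLattice completeLattice public

  field
    ι                   : P.Carrier → Carrier
    isOrderMonomorphism : IsOrderMonomorphism P._≈_ _≈_ P._≤_ _≤_ ι

  ⋀ₛ : Pred P.Carrier ℓ → Carrier
  ⋀ₛ F = ⋀ {Lift κ (Σ P.Carrier F)} (λ j → ι (proj₁ (lower j)))

  ⋁ₛ : Pred P.Carrier ℓ → Carrier
  ⋁ₛ I = ⋁ {Lift κ (Σ P.Carrier I)} (λ j → ι (proj₁ (lower j)))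

  IsClosed : Pred Carrier (suc ℓ ⊔ e)
  IsClosed k = ∃ λ F → DownDirected P F × k ≈ ⋀ₛ F

  IsOpen : Pred Carrier (suc ℓ ⊔ e)
  IsOpen u = ∃ λ I → UpDirected P I × u ≈ ⋁ₛ I

  field
    dense-closed : ∀ u → Σ (Set κ) λ J → Σ (J → Carrier) λ f →
                   (∀ j → IsClosed (f j)) × u ≈ ⋁ f
    dense-open   : ∀ u → Σ (Set κ) λ J → Σ (J → Carrier) λ f →
                   (∀ j → IsOpen (f j)) × u ≈ ⋀ f
    compact      : ∀ F I → DownDirected P F → UpDirected P I → ⋀ₛ F ≤ ⋁ₛ I →
                   ∃ λ a → ∃ λ b → F a × I b × a P.≤ b

  -- The first clause of the σ-extension, used at closed k only; dually below.
  σ-closed : (P.Carrier → Carrier) → Carrier → Carrier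
  σ-closed f k =
    ⋀ {Lift κ (Σ P.Carrier λ a → k ≤ ι a)} (λ j → f (proj₁ (lower j)))

  π-open : (P.Carrier → Carrier) → Carrier → Carrier
  π-open f u =
    ⋁ {Lift κ (Σ P.Carrier λ a → ι a ≤ u)} (λ j → f (proj₁ (lower j)))

  -- The closed elements k ≤ u are enumerated as ⋀ₛ F for the down-directed F
  -- with ⋀ₛ F ≤ u, which keeps the index type small; dually for π.
  infix 9 _^σ _^π

  _^σ : (P.Carrier → Carrier) → Carrier → Carrier
  (f ^σ) u =
    ⋁ {Lift κ (Σ (Pred P.Carrier ℓ) λ F → DownDirected P F × ⋀ₛ F ≤ u)}
      (λ j → σ-closed f (⋀ₛ (proj₁ (lower j))))

  _^π : (P.Carrier → Carrier) → Carrier → Carrier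
  (f ^π) u =
    ⋀ {Lift κ (Σ (Pred P.Carrier ℓ) λ I → UpDirected P I × u ≤ ⋁ₛ I)}
      (λ j → π-open f (⋁ₛ (proj₁ (lower j))))

record IsSubordination {ℓ : Level} (A : BoundedLattice ℓ ℓ ℓ)
       (_≺_ : Rel (BoundedLattice.Carrier A) ℓ) : Set ℓ where
  open BoundedLattice A
  field
    ⊥≺⊥ : ⊥ ≺ ⊥
    ⊤≺⊤ : ⊤ ≺ ⊤
    SI  : ∀ {a b x} → a ≤ b → b ≺ x → a ≺ x
    WO  : ∀ {b x y} → b ≺ x → x ≤ y → b ≺ y
    AND : ∀ {a x y} → a ≺ x → a ≺ y → a ≺ (x ∧ y)
    OR  : ∀ {a b x} → a ≺ x → b ≺ x → (a ∨ b) ≺ x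

record BiSubordinationAlgebra (ℓ : Level) : Set (suc ℓ) where
  infix 4 _≺₁_ _≺₂_
  field
    boundedLattice : BoundedLattice ℓ ℓ ℓ

  open BoundedLattice boundedLattice public

  field
    _≺₁_             : Rel Carrier ℓ
    _≺₂_             : Rel Carrier ℓ
    isSubordination₁ : IsSubordination boundedLattice _≺₁_
    isSubordination₂ : IsSubordination boundedLattice _≺₂_

  P1 : Set ℓ
  P1 = ∀ a b c → c ≺₁ a ∨ b →
       ∀ d → a ≺₂ d → ∃ λ e → e ≺₁ b × c ≤ e ∨ d

  P2 : Set ℓ
  P2 = ∀ a b c → a ∧ b ≺₂ c →
       ∀ d → d ≺₁ a → ∃ λ e → b ≺₂ e × d ∧ e ≤ c

module SlantedOperators {ℓ d e o i : Level} (𝔹 : BiSubordinationAlgebra ℓ)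
       (E : CanonicalExtension (BiSubordinationAlgebra.poset 𝔹) d e o i) where
  open BiSubordinationAlgebra 𝔹 using (_≺₁_; _≺₂_) renaming (Carrier to A)
  open CanonicalExtension E using (Carrier; ⋀ₛ; ⋁ₛ)
  open CanonicalExtension E public using (_^σ; _^π)
    renaming (_≈_ to _≈ᵟ_; _≤_ to _≤ᵟ_; _∨_ to _∨ᵟ_; _∧_ to _∧ᵟ_; ⊤ to ⊤ᵟ; ⊥ to ⊥ᵟ)

  ◇₁ ◇₂ ■₁ ■₂ : A → Carrier
  ◇₁ a = ⋀ₛ (λ b → a ≺₁ b)
  ◇₂ a = ⋀ₛ (λ b → a ≺₂ b)
  ■₁ a = ⋁ₛ (λ b → b ≺₁ a)
  ■₂ a = ⋁ₛ (λ b → b ≺₂ a)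

{-# OPTIONS --safe #-}
-- By compactness, a ≺ b iff ◇ a ≤ ι b, and a ≺ b iff ι a ≤ ■ b, because ◇ a is
-- closed and ■ b is open.  By denseness, an inequality u ≤ v in Aᵟ may be tested
-- on closed elements below u and on open elements above v, where compactness
-- applies again.  The same test gives ⋀ (ι d ∨ u) ≤ ⋀ (ι d) ∨ u for d ranging
-- over a down-directed set, and its dual, on which item 3 rests.
module Submission where

open import Defs
open import Level using (Level; lift; lower)
open import Data.Product using (∃; _×_; _,_; proj₁; proj₂)
open import Function.Bundles using (_⇔_; mk⇔)
open import Relation.Binary.Bundles using (Poset)
open import Relation.Binary.Core using (Rel; _⇒_)
open import Relation.Binary.Construct.Composition using (_;_)
open import Relation.Binary.Lattice.Bundles using (BoundedLattice)
open import Relation.Binary.Lattice.Structures using (IsDistributiveLattice)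
open import Relation.Binary.Morphism.Structures using (IsOrderMonomorphism)
open import Relation.Unary using (Pred)

-- Compactness, denseness and the two extensions of maps in a canonical extension.

module CanonicalExtensionProperties {ℓ d e o i : Level} {P : Poset ℓ ℓ ℓ}
       (E : CanonicalExtension P d e o i) where
  private module P = Poset P
  open CanonicalExtension E
  open IsOrderMonomorphism isOrderMonomorphism public
    using () renaming (mono to ι-mono; cancel to ι-cancel)

  ⋀ₛ-lower : ∀ {F a} → F a → ⋀ₛ F ≤ ι a
  ⋀ₛ-lower p = ⋀-lower _ (lift (_ , p))

  ⋀ₛ-greatest : ∀ {F u} → (∀ {a} → F a → u ≤ ι a) → u ≤ ⋀ₛ F
  ⋀ₛ-greatest h = ⋀-greatest _ _ λ j → h (proj₂ (lower j))

  ⋁ₛ-upper : ∀ {I a} → I a → ι a ≤ ⋁ₛ I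
  ⋁ₛ-upper p = ⋁-upper _ (lift (_ , p))

  ⋁ₛ-least : ∀ {I u} → (∀ {a} → I a → ι a ≤ u) → ⋁ₛ I ≤ u
  ⋁ₛ-least h = ⋁-least _ _ λ j → h (proj₂ (lower j))

  ↑ ↓ : P.Carrier → Pred P.Carrier ℓ
  ↑ a x = a P.≤ x
  ↓ a x = x P.≤ a

  ↑-directed : ∀ a → DownDirected P (↑ a)
  ↑-directed a = (a , P.refl) , λ p q → a , P.refl , p , q

  ↓-directed : ∀ a → UpDirected P (↓ a)
  ↓-directed a = (a , P.refl) , λ p q → a , P.refl , p , q

  -- `ι b` is open, being the join of its principal down-set `↓ b`, so compactness applies to it.
  compact-≤ι : ∀ {F b} → DownDirected P F → ⋀ₛ F ≤ ι b → ∃ λ a → F a × a P.≤ b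
  compact-≤ι {F} {b} dF h
    with a , c , Fa , c≤b , a≤c ← compact F (↓ b) dF (↓-directed b)
                                    (trans h (⋁ₛ-upper P.refl))
    = a , Fa , P.trans a≤c c≤b

  compact-ι≤ : ∀ {I a} → UpDirected P I → ι a ≤ ⋁ₛ I → ∃ λ b → I b × a P.≤ b
  compact-ι≤ {I} {a} dI h
    with c , b , a≤c , Ib , c≤b ← compact (↑ a) I (↑-directed a) dI
                                    (trans (⋀ₛ-lower P.refl) h)
    = b , Ib , P.trans a≤c c≤b

  -- Denseness writes `v` as a meet of open elements; each of them lies above `v`, so it is itself a
  -- test element.
  ≤-by-open : ∀ {u v} →
              (∀ I → UpDirected P I → v ≤ ⋁ₛ I → u ≤ ⋁ₛ I) → u ≤ v
  ≤-by-open {u} {v} h with J , f , f-open , v≈⋀f ← dense-open v =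
    trans (⋀-greatest f u below) (reflexive (Eq.sym v≈⋀f))
    where
    below : ∀ j → u ≤ f j
    below j with I , dI , fj≈⋁I ← f-open j =
      trans (h I dI (trans (reflexive v≈⋀f)
                       (trans (⋀-lower f j) (reflexive fj≈⋁I))))
            (reflexive (Eq.sym fj≈⋁I))

  ≤-by-closed : ∀ {u v} →
                (∀ F → DownDirected P F → ⋀ₛ F ≤ u → ⋀ₛ F ≤ v) → u ≤ v
  ≤-by-closed {u} {v} h with J , f , f-closed , u≈⋁f ← dense-closed u =
    trans (reflexive u≈⋁f) (⋁-least f v above)
    where
    above : ∀ j → f j ≤ v
    above j with F , dF , fj≈⋀F ← f-closed j =
      trans (reflexive fj≈⋀F)
            (h F dF (trans (reflexive (Eq.sym fj≈⋀F))
                       (trans (⋁-upper f j) (reflexive (Eq.sym u≈⋁f)))))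

  -- An open element above `⋀ₛ F ∨ u` is above `⋀ₛ F`, so by compactness it is already above `ι a`
  -- for a single `a` in `F`, and hence above `ι a ∨ u`.
  ⋀ₛ-∨-distrib : ∀ {F u v} → DownDirected P F →
                 (∀ {a} → F a → v ≤ ι a ∨ u) → v ≤ ⋀ₛ F ∨ u
  ⋀ₛ-∨-distrib {F} {u} {v} dF h = ≤-by-open λ I dI p → via I p
    (compact F I dF dI (trans (x≤x∨y _ _) p))
    where
    via : ∀ I → ⋀ₛ F ∨ u ≤ ⋁ₛ I →
          (∃ λ a → ∃ λ b → F a × I b × a P.≤ b) → v ≤ ⋁ₛ I
    via I p (a , b , Fa , Ib , a≤b) =
      trans (h Fa) (∨-least (trans (ι-mono a≤b) (⋁ₛ-upper Ib))
                            (trans (y≤x∨y _ _) p))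

  ⋁ₛ-∧-distrib : ∀ {I u v} → UpDirected P I →
                 (∀ {a} → I a → ι a ∧ u ≤ v) → ⋁ₛ I ∧ u ≤ v
  ⋁ₛ-∧-distrib {I} {u} {v} dI h = ≤-by-closed λ F dF p → via F p
    (compact F I dF dI (trans p (x∧y≤x _ _)))
    where
    via : ∀ F → ⋀ₛ F ≤ ⋁ₛ I ∧ u →
          (∃ λ a → ∃ λ b → F a × I b × a P.≤ b) → ⋀ₛ F ≤ v
    via F p (a , b , Fa , Ib , a≤b) =
      trans (∧-greatest (trans (⋀ₛ-lower Fa) (ι-mono a≤b))
                        (trans p (x∧y≤y _ _)))
            (h Ib)

  module _ {f : P.Carrier → Carrier} where

    ^σ-upper : ∀ {F u} → DownDirected P F → ⋀ₛ F ≤ u →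
               σ-closed f (⋀ₛ F) ≤ (f ^σ) u
    ^σ-upper dF p = ⋁-upper _ (lift (_ , dF , p))

    ^σ-least : ∀ {u v} →
               (∀ F → DownDirected P F → ⋀ₛ F ≤ u → σ-closed f (⋀ₛ F) ≤ v) →
               (f ^σ) u ≤ v
    ^σ-least h = ⋁-least _ _ λ { (lift (F , dF , p)) → h F dF p }

    ^π-lower : ∀ {I u} → UpDirected P I → u ≤ ⋁ₛ I →
               (f ^π) u ≤ π-open f (⋁ₛ I)
    ^π-lower dI p = ⋀-lower _ (lift (_ , dI , p))

    ^π-greatest : ∀ {u v} →
                  (∀ I → UpDirected P I → u ≤ ⋁ₛ I → v ≤ π-open f (⋁ₛ I)) →
                  v ≤ (f ^π) u
    ^π-greatest h = ⋀-greatest _ _ λ { (lift (I , dI , p)) → h I dI p }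

    σ-closed-lower : ∀ {k a} → k ≤ ι a → σ-closed f k ≤ f a
    σ-closed-lower p = ⋀-lower _ (lift (_ , p))

    σ-closed-greatest : ∀ {k u} → (∀ {a} → k ≤ ι a → u ≤ f a) → u ≤ σ-closed f k
    σ-closed-greatest h = ⋀-greatest _ _ λ j → h (proj₂ (lower j))

    π-open-upper : ∀ {u a} → ι a ≤ u → f a ≤ π-open f u
    π-open-upper p = ⋁-upper _ (lift (_ , p))

    π-open-least : ∀ {u v} → (∀ {a} → ι a ≤ u → f a ≤ v) → π-open f u ≤ v
    π-open-least h = ⋁-least _ _ λ j → h (proj₂ (lower j))

    -- `⋀ₛ (↑ b)` is a closed element equal to `ι b`, and by monotonicity `f b` is the least of the
    -- values met in `σ-closed f` there. Allowing any `u` above `ι b` builds in the monotonicity of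
    -- `f ^σ`.
    ≤^σ-ι : (∀ {x y} → x P.≤ y → f x ≤ f y) →
            ∀ {b u} → ι b ≤ u → f b ≤ (f ^σ) u
    ≤^σ-ι f-mono {b} p = trans
      (σ-closed-greatest λ q →
        f-mono (ι-cancel (trans (⋀ₛ-greatest ι-mono) q)))
      (^σ-upper (↑-directed b) (trans (⋀ₛ-lower P.refl) p))

    ^π-ι≤ : (∀ {x y} → x P.≤ y → f x ≤ f y) →
            ∀ {c u} → u ≤ ι c → (f ^π) u ≤ f c
    ^π-ι≤ f-mono {c} p = trans
      (^π-lower (↓-directed c) (trans p (⋁ₛ-upper P.refl)))
      (π-open-least λ q →
        f-mono (ι-cancel (trans q (⋁ₛ-least ι-mono))))

    -- Every closed `k` below `u` is below `ι b`, so `f b` is among the values whose meet is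
    -- `σ-closed f k`.
    ^σ-≤ι : ∀ {b u} → u ≤ ι b → (f ^σ) u ≤ f b
    ^σ-≤ι p = ^σ-least λ F dF q → σ-closed-lower (trans q p)

    ι≤-^π : ∀ {b u} → ι b ≤ u → f b ≤ (f ^π) u
    ι≤-^π p = ^π-greatest λ I dI q → π-open-upper (trans p q)

-- A single subordination relation and its two operators.

module SubordinationProperties {ℓ d e o i : Level} (A : BoundedLattice ℓ ℓ ℓ)
       (E : CanonicalExtension (BoundedLattice.poset A) d e o i)
       {_≺_ : Rel (BoundedLattice.Carrier A) ℓ}
       (isSubordination : IsSubordination A _≺_) where
  private module A = BoundedLattice A
  open CanonicalExtension E
  open CanonicalExtensionProperties E
  open IsSubordination isSubordination

  ◇ ■ : A.Carrier → Carrier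
  ◇ a = ⋀ₛ (λ b → a ≺ b)
  ■ a = ⋁ₛ (λ b → b ≺ a)

  ◇-directed : ∀ a → DownDirected A.poset (λ b → a ≺ b)
  ◇-directed a = (A.⊤ , SI (A.maximum a) ⊤≺⊤) ,
    λ p q → _ , AND p q , A.x∧y≤x _ _ , A.x∧y≤y _ _

  ■-directed : ∀ a → UpDirected A.poset (λ b → b ≺ a)
  ■-directed a = (A.⊥ , WO ⊥≺⊥ (A.minimum a)) ,
    λ p q → _ , OR p q , A.x≤x∨y _ _ , A.y≤x∨y _ _

  ◇≤ι⇒≺ : ∀ {a b} → ◇ a ≤ ι b → a ≺ b
  ◇≤ι⇒≺ {a} p with x , a≺x , x≤b ← compact-≤ι (◇-directed a) p = WO a≺x x≤b

  ι≤■⇒≺ : ∀ {a b} → ι a ≤ ■ b → a ≺ b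
  ι≤■⇒≺ {b = b} p with x , x≺b , a≤x ← compact-ι≤ (■-directed b) p = SI a≤x x≺b

  -- Compactness gives some `x` with `a ≺ x` below a member `b` of `I`; `WO` then transfers the
  -- relation to `b` itself.
  ◇≤⋁ₛ⇒≺ : ∀ {a I} → UpDirected A.poset I → ◇ a ≤ ⋁ₛ I → ∃ λ b → I b × a ≺ b
  ◇≤⋁ₛ⇒≺ {a} {I} dI p
    with x , b , a≺x , Ib , x≤b ← compact _ I (◇-directed a) dI p
    = b , Ib , WO a≺x x≤b

  ⋀ₛ≤■⇒≺ : ∀ {a F} → DownDirected A.poset F → ⋀ₛ F ≤ ■ a → ∃ λ b → F b × b ≺ a
  ⋀ₛ≤■⇒≺ {a} {F} dF p
    with b , x , Fb , x≺a , b≤x ← compact F _ dF (■-directed a) p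
    = b , Fb , SI b≤x x≺a

  ◇-mono : ∀ {a b} → a A.≤ b → ◇ a ≤ ◇ b
  ◇-mono a≤b = ⋀ₛ-greatest λ b≺x → ⋀ₛ-lower (SI a≤b b≺x)

  ■-mono : ∀ {a b} → a A.≤ b → ■ a ≤ ■ b
  ■-mono a≤b = ⋁ₛ-least λ x≺a → ⋁ₛ-upper (WO x≺a a≤b)

-- The correspondences between conditions on two subordinations and inequalities.

module BiSubordinationProperties {ℓ d e o i : Level}
       (𝔹 : BiSubordinationAlgebra ℓ)
       (Aᵟ : CanonicalExtension (BiSubordinationAlgebra.poset 𝔹) d e o i) where
  private
    module E = CanonicalExtension Aᵟ
    open BiSubordinationAlgebra 𝔹
    open SlantedOperators 𝔹 Aᵟ
    open E using (ι; ⋀ₛ; ⋁ₛ)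
    open CanonicalExtensionProperties Aᵟ
    module S₁ where
      open IsSubordination isSubordination₁ public
      open SubordinationProperties boundedLattice Aᵟ isSubordination₁ public
    module S₂ where
      open IsSubordination isSubordination₂ public
      open SubordinationProperties boundedLattice Aᵟ isSubordination₂ public

  -- An order embedding need not preserve bounds. Here it does because directed sets are nonempty:
  -- every closed element lies below some `ι a`.
  ⊤ᵟ≤ι⊤ : ⊤ᵟ ≤ᵟ ι ⊤
  ⊤ᵟ≤ι⊤ = ≤-by-closed λ { F ((a , Fa) , _) _ →
    E.trans (⋀ₛ-lower Fa) (ι-mono (maximum a)) }

  ι⊥≤⊥ᵟ : ι ⊥ ≤ᵟ ⊥ᵟ
  ι⊥≤⊥ᵟ = ≤-by-open λ { I ((a , Ia) , _) _ →
    E.trans (ι-mono (minimum a)) (⋁ₛ-upper Ia) }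

  ≺₁⊆≺₂⇔◇₂≤◇₁ : (_≺₁_ ⇒ _≺₂_) ⇔ (∀ a → ◇₂ a ≤ᵟ ◇₁ a)
  ≺₁⊆≺₂⇔◇₂≤◇₁ = mk⇔
    (λ h a → ⋀ₛ-greatest λ a≺₁b → ⋀ₛ-lower (h a≺₁b))
    (λ h {a} {b} a≺₁b → S₂.◇≤ι⇒≺ (E.trans (h _) (⋀ₛ-lower a≺₁b)))

  ≺₂;≺₁⊆≤⇔■₂≤◇₁ : ((_≺₂_ ; _≺₁_) ⇒ _≤_) ⇔ (∀ a → ■₂ a ≤ᵟ ◇₁ a)
  ≺₂;≺₁⊆≤⇔■₂≤◇₁ = mk⇔
    (λ h a → ⋁ₛ-least λ b≺₂a → ⋀ₛ-greatest λ a≺₁c →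
      ι-mono (h (a , b≺₂a , a≺₁c)))
    (λ { h (a , b≺₂a , a≺₁c) →
      ι-cancel (E.trans (⋁ₛ-upper b≺₂a) (E.trans (h a) (⋀ₛ-lower a≺₁c))) })

  P1⇔■₁∨≤◇₂∨■₁ : P1 ⇔ (∀ a b → ■₁ (a ∨ b) ≤ᵟ (◇₂ a ∨ᵟ ■₁ b))
  P1⇔■₁∨≤◇₂∨■₁ = mk⇔ to from
    where
    to : P1 → ∀ a b → ■₁ (a ∨ b) ≤ᵟ (◇₂ a ∨ᵟ ■₁ b)
    to p1 a b = ⋁ₛ-least λ {c} c≺₁a∨b → ⋀ₛ-∨-distrib (S₂.◇-directed a)
      λ {d} a≺₂d → ιc≤ (p1 a b c c≺₁a∨b d a≺₂d)
      where
      -- An open element above `ι x` and `ι y` has, by compactness, members above `x` and above `y`;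
      -- directedness gives one member above both.
      ι-∨ : ∀ {x y} → ι (x ∨ y) ≤ᵟ (ι x ∨ᵟ ι y)
      ι-∨ = ≤-by-open λ I dI p →
        let x' , Ix' , x≤x' = compact-ι≤ dI (E.trans (E.x≤x∨y _ _) p)
            y' , Iy' , y≤y' = compact-ι≤ dI (E.trans (E.y≤x∨y _ _) p)
            z , Iz , x'≤z , y'≤z = proj₂ dI Ix' Iy'
        in E.trans (ι-mono (∨-least (trans x≤x' x'≤z) (trans y≤y' y'≤z)))
                   (⋁ₛ-upper Iz)

      ιc≤ : ∀ {c d} → (∃ λ e → e ≺₁ b × c ≤ e ∨ d) → ι c ≤ᵟ (ι d ∨ᵟ ■₁ b)
      ιc≤ (e , e≺₁b , c≤e∨d) = E.trans (ι-mono c≤e∨d) (E.trans ι-∨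
        (E.∨-least (E.trans (⋁ₛ-upper e≺₁b) (E.y≤x∨y _ _)) (E.x≤x∨y _ _)))

    -- ⋁ₛ (I b d) is ι d ∨ᵟ ■₁ b.
    I : (b d : Carrier) → Pred Carrier _
    I b d x = ∃ λ e → e ≺₁ b × x ≤ e ∨ d

    directed : ∀ b d → UpDirected poset (I b d)
    -- The member `d` comes from `e = ⊥`; two members are bounded by their join, with `e ∨ e'` as
    -- its witness.
    directed b d = (d , ⊥ , S₁.WO S₁.⊥≺⊥ (minimum b) , y≤x∨y _ _) ,
      λ { (e , e≺₁b , x≤) (e' , e'≺₁b , y≤) →
        _ , (e ∨ e' , S₁.OR e≺₁b e'≺₁b ,
          ∨-least
            (trans x≤ (∨-least (trans (x≤x∨y _ _) (x≤x∨y _ _)) (y≤x∨y _ _)))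
            (trans y≤ (∨-least (trans (y≤x∨y _ _) (x≤x∨y _ _)) (y≤x∨y _ _)))) ,
        x≤x∨y _ _ , y≤x∨y _ _ }

    from : (∀ a b → ■₁ (a ∨ b) ≤ᵟ (◇₂ a ∨ᵟ ■₁ b)) → P1
    from h a b c c≺₁a∨b d a≺₂d
      -- Since `◇₂ a ≤ ι d`, the hypothesis puts `ι c` below the open element `ι d ∨ᵟ ■₁ b`.
      -- Compactness finds a member of `I b d` above `c`, and its witness is the required `e`.
      with x , (e , e≺₁b , x≤e∨d) , c≤x ← compact-ι≤ (directed b d) (E.trans
             (⋁ₛ-upper c≺₁a∨b) (E.trans (h a b) (E.∨-least
               (E.trans (⋀ₛ-lower a≺₂d)
                 (⋁ₛ-upper (⊥ , S₁.WO S₁.⊥≺⊥ (minimum b) , y≤x∨y _ _)))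
               (⋁ₛ-least λ {e} e≺₁b → ⋁ₛ-upper (e , e≺₁b , x≤x∨y _ _)))))
      = e , e≺₁b , trans c≤x x≤e∨d

  -- Order dual of the argument for `P1`: now `ι d ∧ᵟ ◇₂ b` is closed and compactness is applied
  -- below `ι c`.
  P2⇔■₁∧◇₂≤◇₂∧ : P2 ⇔ (∀ a b → (■₁ a ∧ᵟ ◇₂ b) ≤ᵟ ◇₂ (a ∧ b))
  P2⇔■₁∧◇₂≤◇₂∧ = mk⇔ to from
    where
    to : P2 → ∀ a b → (■₁ a ∧ᵟ ◇₂ b) ≤ᵟ ◇₂ (a ∧ b)
    to p2 a b = ⋀ₛ-greatest λ {c} a∧b≺₂c → ⋁ₛ-∧-distrib (S₁.■-directed a)
      λ {d} d≺₁a → ≤ιc (p2 a b c a∧b≺₂c d d≺₁a)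
      where
      ι-∧ : ∀ {x y} → (ι x ∧ᵟ ι y) ≤ᵟ ι (x ∧ y)
      ι-∧ = ≤-by-closed λ F dF p →
        let x' , Fx' , x'≤x = compact-≤ι dF (E.trans p (E.x∧y≤x _ _))
            y' , Fy' , y'≤y = compact-≤ι dF (E.trans p (E.x∧y≤y _ _))
            z , Fz , z≤x' , z≤y' = proj₂ dF Fx' Fy'
        in E.trans (⋀ₛ-lower Fz)
                   (ι-mono (∧-greatest (trans z≤x' x'≤x) (trans z≤y' y'≤y)))

      ≤ιc : ∀ {c d} → (∃ λ e → b ≺₂ e × d ∧ e ≤ c) → (ι d ∧ᵟ ◇₂ b) ≤ᵟ ι c
      ≤ιc (e , b≺₂e , d∧e≤c) = E.trans
        (E.∧-greatest (E.x∧y≤x _ _) (E.trans (E.x∧y≤y _ _) (⋀ₛ-lower b≺₂e)))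
        (E.trans ι-∧ (ι-mono d∧e≤c))

    -- ⋀ₛ (F b d) is ι d ∧ᵟ ◇₂ b.
    F : (b d : Carrier) → Pred Carrier _
    F b d x = ∃ λ e → b ≺₂ e × d ∧ e ≤ x

    directed : ∀ b d → DownDirected poset (F b d)
    directed b d = (d , ⊤ , S₂.SI (maximum b) S₂.⊤≺⊤ , x∧y≤x _ _) ,
      λ { (e , b≺₂e , ≤x) (e' , b≺₂e' , ≤y) →
        _ , (e ∧ e' , S₂.AND b≺₂e b≺₂e' ,
          ∧-greatest
            (trans (∧-greatest (x∧y≤x _ _) (trans (x∧y≤y _ _) (x∧y≤x _ _))) ≤x)
            (trans (∧-greatest (x∧y≤x _ _) (trans (x∧y≤y _ _) (x∧y≤y _ _))) ≤y)) ,
        x∧y≤x _ _ , x∧y≤y _ _ }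

    from : (∀ a b → (■₁ a ∧ᵟ ◇₂ b) ≤ᵟ ◇₂ (a ∧ b)) → P2
    from h a b c a∧b≺₂c d d≺₁a
      with x , (e , b≺₂e , d∧e≤x) , x≤c ← compact-≤ι (directed b d) (E.trans
             (E.∧-greatest
               (E.trans
                 (⋀ₛ-lower (⊤ , S₂.SI (maximum b) S₂.⊤≺⊤ , x∧y≤x _ _))
                 (⋁ₛ-upper d≺₁a))
               (⋀ₛ-greatest λ {e} b≺₂e → ⋀ₛ-lower (e , b≺₂e , x∧y≤y _ _)))
             (E.trans (h a b) (⋀ₛ-lower a∧b≺₂c)))
      = e , b≺₂e , trans d∧e≤x x≤c

  ≺₂;≺₁⊆≺₁;≺₂⇔◇₁■₂≤■₂◇₁ : ((_≺₂_ ; _≺₁_) ⇒ (_≺₁_ ; _≺₂_)) ⇔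
                          (∀ a → (◇₁ ^σ) (■₂ a) ≤ᵟ (■₂ ^π) (◇₁ a))
  ≺₂;≺₁⊆≺₁;≺₂⇔◇₁■₂≤■₂◇₁ = mk⇔ to from
    where
    to : ((_≺₂_ ; _≺₁_) ⇒ (_≺₁_ ; _≺₂_)) → ∀ a → (◇₁ ^σ) (■₂ a) ≤ᵟ (■₂ ^π) (◇₁ a)
    to h a = ^σ-least λ F dF p → ^π-greatest λ I dI q →
      let b , Fb , b≺₂a = S₂.⋀ₛ≤■⇒≺ dF p
          c , Ic , a≺₁c = S₁.◇≤⋁ₛ⇒≺ dI q
          z , b≺₁z , z≺₂c = h (a , b≺₂a , a≺₁c)
      -- The chain runs through `◇₁ b ≤ ι z ≤ ■₂ c`, with `z` interpolated by the inclusion.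
      in E.trans (σ-closed-lower (⋀ₛ-lower Fb))
           (E.trans (⋀ₛ-lower b≺₁z)
             (E.trans (⋁ₛ-upper z≺₂c) (π-open-upper (⋁ₛ-upper Ic))))

    from : (∀ a → (◇₁ ^σ) (■₂ a) ≤ᵟ (■₂ ^π) (◇₁ a)) → (_≺₂_ ; _≺₁_) ⇒ (_≺₁_ ; _≺₂_)
    from h (a , b≺₂a , a≺₁c) =
      -- The two extensions are bounded by their values on `A`, so `◇₁ b ≤ ■₂ c`; compactness
      -- between this closed and this open element yields `z`.
      let z , z≺₂c , b≺₁z = S₁.◇≤⋁ₛ⇒≺ (S₂.■-directed _)
            (E.trans (≤^σ-ι S₁.◇-mono (⋁ₛ-upper b≺₂a))
              (E.trans (h a) (^π-ι≤ S₂.■-mono (⋀ₛ-lower a≺₁c))))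
      in z , b≺₁z , z≺₂c

  ≺₁;≺₂⊆≺₁⇔◇₁≤◇₂◇₁ : ((_≺₁_ ; _≺₂_) ⇒ _≺₁_) ⇔
                      (∀ a → ◇₁ a ≤ᵟ (◇₂ ^σ) (◇₁ a))
  ≺₁;≺₂⊆≺₁⇔◇₁≤◇₂◇₁ = mk⇔
    (λ h a → E.trans
      (σ-closed-greatest λ ◇₁a≤ιx → ⋀ₛ-greatest λ x≺₂y →
        ⋀ₛ-lower (h (_ , S₁.◇≤ι⇒≺ ◇₁a≤ιx , x≺₂y)))
      (^σ-upper (S₁.◇-directed a) E.refl))
    (λ { h (x , a≺₁x , x≺₂y) → S₁.◇≤ι⇒≺
      (E.trans (h _) (E.trans (^σ-≤ι (⋀ₛ-lower a≺₁x)) (⋀ₛ-lower x≺₂y))) })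

  -- An open element above the join has one member related to `a` by `≺₁` and one by `≺₂`; a common
  -- upper bound in the directed set is related by both, hence is `⊤`.
  ≺₁∩≺₂⇒⊤⇔◇₁∨◇₂≈⊤ : (∀ a b → (a ≺₁ b × a ≺₂ b) → b ≈ ⊤) ⇔
                     (∀ a → (◇₁ a ∨ᵟ ◇₂ a) ≈ᵟ ⊤ᵟ)
  ≺₁∩≺₂⇒⊤⇔◇₁∨◇₂≈⊤ = mk⇔
    (λ h a → E.antisym (E.maximum _) (≤-by-open λ I dI p →
      let b , Ib , a≺₁b = S₁.◇≤⋁ₛ⇒≺ dI (E.trans (E.x≤x∨y _ _) p)
          c , Ic , a≺₂c = S₂.◇≤⋁ₛ⇒≺ dI (E.trans (E.y≤x∨y _ _) p)
          z , Iz , b≤z , c≤z = proj₂ dI Ib Ic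
          z≈⊤ = h a z (S₁.WO a≺₁b b≤z , S₂.WO a≺₂c c≤z)
      in E.trans ⊤ᵟ≤ι⊤ (E.trans (ι-mono (reflexive (Eq.sym z≈⊤))) (⋁ₛ-upper Iz))))
    (λ { h a b (a≺₁b , a≺₂b) → antisym (maximum b) (ι-cancel
      (E.trans (E.maximum _) (E.trans (E.reflexive (E.Eq.sym (h a)))
        (E.∨-least (⋀ₛ-lower a≺₁b) (⋀ₛ-lower a≺₂b))))) })

  -- By `SI`, all `a` are related to `b` as soon as `⊤` is, so both quantifiers over `a` reduce to
  -- the case of `⊤`.
  ∀≺₁⇒∀≺₂⇔◇₂⊤≤◇₁⊤ : (∀ b → (∀ a → a ≺₁ b) → (∀ a → a ≺₂ b)) ⇔ (◇₂ ⊤ ≤ᵟ ◇₁ ⊤)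
  ∀≺₁⇒∀≺₂⇔◇₂⊤≤◇₁⊤ = mk⇔
    (λ h → ⋀ₛ-greatest λ ⊤≺₁b →
      ⋀ₛ-lower (h _ (λ a → S₁.SI (maximum a) ⊤≺₁b) ⊤))
    (λ h b ∀≺₁b a → S₂.SI (maximum a)
      (S₂.◇≤ι⇒≺ (E.trans h (⋀ₛ-lower (∀≺₁b ⊤)))))

  ≺₁;≺₂⊥⇒⊥⇔■₁■₂⊥≈⊥ : (∀ a → (∃ λ b → a ≺₁ b × b ≺₂ ⊥) → a ≈ ⊥) ⇔
                      ((■₁ ^π) (■₂ ⊥) ≈ᵟ ⊥ᵟ)
  ≺₁;≺₂⊥⇒⊥⇔■₁■₂⊥≈⊥ = mk⇔
    (λ h → E.antisym
      (E.trans (^π-lower (S₂.■-directed ⊥) E.refl)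
        (π-open-least λ {b} ιb≤■₂⊥ → ⋁ₛ-least λ {a} a≺₁b →
          E.trans (ι-mono (reflexive (h a (b , a≺₁b , S₂.ι≤■⇒≺ ιb≤■₂⊥)))) ι⊥≤⊥ᵟ))
      (E.minimum _))
    (λ { h a (b , a≺₁b , b≺₂⊥) → antisym
      (ι-cancel (E.trans (⋁ₛ-upper a≺₁b) (E.trans (ι≤-^π (⋁ₛ-upper b≺₂⊥))
        (E.trans (E.reflexive h) (E.minimum _)))))
      (minimum a) })

proposition5p5 :
  ∀ {ℓ d e o i} (𝔹 : BiSubordinationAlgebra ℓ)
    (Aᵟ : CanonicalExtension (BiSubordinationAlgebra.poset 𝔹) d e o i) →
  let open BiSubordinationAlgebra 𝔹
      open SlantedOperators 𝔹 Aᵟ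
  in
    ((_≺₁_ ⇒ _≺₂_) ⇔ (∀ a → ◇₂ a ≤ᵟ ◇₁ a))
  × (((_≺₂_ ; _≺₁_) ⇒ _≤_) ⇔ (∀ a → ■₂ a ≤ᵟ ◇₁ a))
  × (IsDistributiveLattice _≈_ _≤_ _∨_ _∧_ →
        (P1 ⇔ (∀ a b → ■₁ (a ∨ b) ≤ᵟ (◇₂ a ∨ᵟ ■₁ b)))
      × (P2 ⇔ (∀ a b → (■₁ a ∧ᵟ ◇₂ b) ≤ᵟ ◇₂ (a ∧ b))))
  × (((_≺₂_ ; _≺₁_) ⇒ (_≺₁_ ; _≺₂_)) ⇔ (∀ a → (◇₁ ^σ) (■₂ a) ≤ᵟ (■₂ ^π) (◇₁ a)))
  × (((_≺₁_ ; _≺₂_) ⇒ _≺₁_) ⇔ (∀ a → ◇₁ a ≤ᵟ (◇₂ ^σ) (◇₁ a)))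
  × ((∀ a b → (a ≺₁ b × a ≺₂ b) → b ≈ ⊤) ⇔ (∀ a → (◇₁ a ∨ᵟ ◇₂ a) ≈ᵟ ⊤ᵟ))
  × ((∀ b → (∀ a → a ≺₁ b) → (∀ a → a ≺₂ b)) ⇔ (◇₂ ⊤ ≤ᵟ ◇₁ ⊤))
  × ((∀ a → (∃ λ b → a ≺₁ b × b ≺₂ ⊥) → a ≈ ⊥) ⇔ ((■₁ ^π) (■₂ ⊥) ≈ᵟ ⊥ᵟ))
proposition5p5 𝔹 Aᵟ =
    ≺₁⊆≺₂⇔◇₂≤◇₁
  , ≺₂;≺₁⊆≤⇔■₂≤◇₁
  , (λ _ → P1⇔■₁∨≤◇₂∨■₁ , P2⇔■₁∧◇₂≤◇₂∧)
  , ≺₂;≺₁⊆≺₁;≺₂⇔◇₁■₂≤■₂◇₁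
  , ≺₁;≺₂⊆≺₁⇔◇₁≤◇₂◇₁
  , ≺₁∩≺₂⇒⊤⇔◇₁∨◇₂≈⊤
  , ∀≺₁⇒∀≺₂⇔◇₂⊤≤◇₁⊤
  , ≺₁;≺₂⊥⇒⊥⇔■₁■₂⊥≈⊥
  where open BiSubordinationProperties 𝔹 Aᵟ
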